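{- For each $r\in\{1,2,3\}$ there exist graphs $G_r$ and $H_r$ with $\omega^{(r)}(G_r)=\omega^{(r)}(H_r)$ but $\omega^{(r+1)}(G_r)\ne\omega^{(r+1)}(H_r)$. Hence $\omega^{(1)}$, $\omega^{(2)}$, $\omega^{(3)}$ are strictly weaker than $\omega^{(2)}$, $\omega^{(3)}$, $\omega^{(4)}$ respectively.
   Context: Graphs are finite, simple and undirected; an $N$-vertex graph has $V(G)=\{1,\dots,N\}$. Let $w_k(x,y)$ be the number of walks of length $k$ from $x$ to $y$, $w_*(x,y)=(w_0(x,y),\dots,w_{N-1}(x,y))$. Define $\omega_0(x)=w_*(x,x)$, $\omega_{r+1}(x)=\big(\omega_r(x),\{\!\{(w_*(x,y),\omega_r(y))\}\!\}_{y\in V(G)}\big)$, where $\{\!\{\cdot\}\!\}$ denotes a multiset, and $\omega^{(r)}(G)=\{\!\{\omega_r(x)\}\!\}_{x\in V(G)}$. -}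

module Defs where

open import Level using (0ℓ)
open import Data.Bool.Base using (Bool; true; false; T)
open import Data.Empty using (⊥)
open import Data.Fin.Base using (Fin; zero; suc)
open import Data.Fin.Properties using (_≟_; +↔⊎; 0↔⊥)
open import Data.List.Base using (List; map; upTo; allFin)
import Data.List.Relation.Binary.Permutation.Setoid as Permutation
open import Data.Nat.Base using (ℕ; zero; suc; _+_)
open import Data.Product.Base using (Σ; ∃; _×_; _,_; proj₁)
open import Data.Product.Relation.Binary.Pointwise.NonDependent using (×-setoid)
open import Data.Sum.Base using (_⊎_; inj₁; inj₂)
open import Data.Sum.Function.Propositional using (_⊎-↔_)
open import Data.Unit.Base using (tt)
open import Function.Base using (_∘_)
open import Function.Bundles using (_↔_; mk↔ₛ′)
open import Function.Construct.Composition using (_↔-∘_)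
open import Function.Construct.Symmetry using (↔-sym)
open import Relation.Binary.Bundles using (Setoid)
open import Relation.Binary.Definitions using (Symmetric; Irreflexive)
open import Relation.Binary.PropositionalEquality.Core using (_≡_; _≢_; refl)
open import Relation.Binary.PropositionalEquality.Properties using (setoid)
open import Relation.Nullary using (¬_; yes; no; contradiction)

Finite : Set → Set
Finite A = ∃ λ n → A ↔ Fin n

card : {A : Set} → Finite A → ℕ
card = proj₁

finite-via : {A B : Set} → A ↔ B → Finite B → Finite A
finite-via f (n , g) = n , g ↔-∘ f

Σ-zero↔ : {B : Fin zero → Set} → Σ (Fin zero) B ↔ ⊥
Σ-zero↔ = mk↔ₛ′ (λ ()) (λ ()) (λ ()) (λ ())

Σ-suc↔ : ∀ {n} {B : Fin (suc n) → Set} →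
         Σ (Fin (suc n)) B ↔ (B zero ⊎ Σ (Fin n) (B ∘ suc))
Σ-suc↔ = mk↔ₛ′
  (λ { (zero , b) → inj₁ b ; (suc i , b) → inj₂ (i , b) })
  (λ { (inj₁ b) → zero , b ; (inj₂ (i , b)) → suc i , b })
  (λ { (inj₁ _) → refl ; (inj₂ _) → refl })
  (λ { (zero , _) → refl ; (suc _ , _) → refl })

⊥-finite : Finite ⊥
⊥-finite = 0 , ↔-sym 0↔⊥

⊎-finite : {A B : Set} → Finite A → Finite B → Finite (A ⊎ B)
⊎-finite (m , f) (n , g) = m + n , ↔-sym +↔⊎ ↔-∘ (f ⊎-↔ g)

Σ-finite : ∀ {n} {B : Fin n → Set} → (∀ i → Finite (B i)) → Finite (Σ (Fin n) B)
Σ-finite {zero}  B-fin = finite-via Σ-zero↔ ⊥-finite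
Σ-finite {suc n} B-fin =
  finite-via Σ-suc↔ (⊎-finite (B-fin zero) (Σ-finite (B-fin ∘ suc)))

T×-finite : ∀ b {A : Set} → Finite A → Finite (T b × A)
T×-finite true  A-fin =
  finite-via (mk↔ₛ′ (λ { (_ , a) → a }) (tt ,_) (λ _ → refl) (λ _ → refl)) A-fin
T×-finite false A-fin =
  finite-via (mk↔ₛ′ (λ { (() , _) }) (λ ()) (λ ()) (λ { (() , _) })) ⊥-finite

record Graph : Set where
  field
    order : ℕ
    adj   : Fin order → Fin order → Bool

  Vertex : Set
  Vertex = Fin order

  -- T b has at most one element, so there are no multiple edges.
  Adj : Vertex → Vertex → Set
  Adj x y = T (adj x y)

  field
    symmetric   : Symmetric Adj
    irreflexive : Irreflexive _≡_ Adj

module _ (G : Graph) where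
  open Graph G

  data Walk : ℕ → Vertex → Vertex → Set where
    stop : ∀ {x} → Walk zero x x
    step : ∀ {k x y z} → Adj x y → Walk k y z → Walk (suc k) x z

  Walk-zero-refl↔ : ∀ {x} → Walk zero x x ↔ Fin 1
  Walk-zero-refl↔ =
    mk↔ₛ′ (λ _ → zero) (λ _ → stop) (λ { zero → refl }) (λ { stop → refl })

  Walk-zero-≢↔ : ∀ {x y} → x ≢ y → Walk zero x y ↔ ⊥
  Walk-zero-≢↔ x≢y = mk↔ₛ′ (λ { stop → x≢y refl }) (λ ()) (λ ())
                           (λ { stop → contradiction refl x≢y })

  Walk-suc↔ : ∀ {k x z} →
              Walk (suc k) x z ↔ Σ Vertex (λ y → Adj x y × Walk k y z)
  Walk-suc↔ = mk↔ₛ′ (λ { (step {y = y} e p) → y , e , p })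
                    (λ { (_ , e , p) → step e p })
                    (λ _ → refl)
                    (λ { (step _ _) → refl })

  Walk-finite : ∀ k x y → Finite (Walk k x y)
  Walk-finite zero x y with x ≟ y
  ... | yes refl = 1 , Walk-zero-refl↔
  ... | no  x≢y  = finite-via (Walk-zero-≢↔ x≢y) ⊥-finite
  Walk-finite (suc k) x z = finite-via Walk-suc↔
    (Σ-finite (λ y → T×-finite (adj x y) (Walk-finite k y z)))

  w : ℕ → Vertex → Vertex → ℕ
  w k x y = card (Walk-finite k x y)

  w* : Vertex → Vertex → List ℕ
  w* x y = map (λ k → w k x y) (upTo order)

-- A multiset over a setoid is a list taken up to permutation, where
-- permutations compare entries by the setoid's equality.
multiset : Setoid 0ℓ 0ℓ → Setoid 0ℓ 0ℓ
multiset S = Permutation.↭-setoid S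

-- Sequences w* are lists rather than vectors so that colours of vertices
-- in graphs of different orders live in the same setoid.
Colour : ℕ → Setoid 0ℓ 0ℓ
Colour zero    = setoid (List ℕ)
Colour (suc r) =
  ×-setoid (Colour r) (multiset (×-setoid (setoid (List ℕ)) (Colour r)))

ω : ∀ r (G : Graph) → Graph.Vertex G → Setoid.Carrier (Colour r)
ω zero    G x = w* G x x
ω (suc r) G x = ω r G x , map (λ y → w* G x y , ω r G y) (allFin (Graph.order G))

profile : ∀ r → Graph → Setoid.Carrier (multiset (Colour r))
profile r G = map (ω r G) (allFin (Graph.order G))

-- G ≈[ r ] H says that ω⁽ʳ⁾(G) and ω⁽ʳ⁾(H) are equal as multisets.
infix 4 _≈[_]_
_≈[_]_ : Graph → ℕ → Graph → Set
G ≈[ r ] H = Setoid._≈_ (multiset (Colour r)) (profile r G) (profile r H)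

_Determines_ : ℕ → ℕ → Set
s Determines r = ∀ G H → G ≈[ s ] H → G ≈[ r ] H

_StrictlyWeakerThan_ : ℕ → ℕ → Set
r StrictlyWeakerThan s = s Determines r × ¬ (r Determines s)

{-# OPTIONS --safe #-}
module Submission where

-- All graphs are incidence graphs of 2-(9,3,2) designs.  There w_k(x,y)
-- depends only on the relation of x and y: equal or distinct points, incidence
-- of a point and a block, equality or intersection size of two blocks.  Indeed,
-- one step added at a suitable end of a walk meets each relation a number of
-- times that depends only on the relation of the endpoints.  So ω_r is colour
-- refinement on the points and blocks: ω_1 sees little more than which blocks
-- are repeated, and the position of the repeated blocks spreads slowly from
-- there.  A computer search among these designs gives the pairs.  Equality of
-- two profiles is verified by naming each colour by a vertex of the first graph,
-- level by level.  Inequality is verified by hashing ω_{r+1}(x) to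
-- (Σ_y w_2(x,y)³ h_r(y))², where h_r(y) is the hash of ω_r(y), and summing over x.

open import Defs
open import Level using (0ℓ)
open import Data.Bool.Base using (Bool; true; false; T; _∧_; if_then_else_)
open import Data.Bool.ListAction using (any)
open import Data.Bool.Properties using (T-irrelevant)
open import Data.Fin.Base using (Fin; zero; suc; toℕ; splitAt)
import Data.Fin.Properties as Fin
open import Data.Fin.Permutation using (↔⇒≡)
open import Data.List.Base
  using (List; []; _∷_; _++_; map; allFin; tabulate; filterᵇ; upTo; replicate; length)
import Data.List.Properties as List
open import Data.List.Relation.Binary.Permutation.Propositional using (↭-sym; ↭⇒↭ₛ′; ↭ₛ⇒↭)
open import Data.List.Relation.Binary.Permutation.Propositional.Properties using (map⁺)
import Data.List.Relation.Binary.Permutation.Setoid as Permutation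
import Data.List.Relation.Binary.Permutation.Setoid.Properties as Permutationₚ
import Data.List.Relation.Binary.Pointwise as Pointwise
import Data.List.Sort.InsertionSort as InsertionSort
open import Data.List.Sort.Base using (SortingAlgorithm)
open import Data.Nat.Base
  using (ℕ; zero; suc; _≤_; s≤s; _+_; _*_; _^_; _∸_; _/_; _%_; _≡ᵇ_)
open import Data.Nat.ListAction using (sum)
open import Data.Nat.ListAction.Properties using (sum-↭)
import Data.Nat.Properties as ℕ
open import Data.Product.Base using (_×_; _,_; proj₁; proj₂; ∃₂)
import Data.Product.Properties as Product
open import Data.Product.Relation.Binary.Lex.NonStrict using (×-decTotalOrder)
open import Data.Product.Relation.Binary.Pointwise.NonDependent using (×-setoid)
open import Data.Sum.Base using (_⊎_; inj₁; inj₂)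
open import Data.Unit.Base using (tt)
open import Data.Vec.Base as Vec using (Vec; []; _∷_; lookup)
open import Data.Vec.Properties using (lookup∘tabulate; lookup-replicate)
open import Function.Base using (_∘_; id)
open import Function.Bundles using (_↔_; mk↔ₛ′)
open import Function.Construct.Composition using (_↔-∘_)
open import Function.Construct.Symmetry using (↔-sym)
open import Relation.Binary.Bundles using (Setoid; DecTotalOrder)
open import Relation.Binary.Definitions using (DecidableEquality)
open import Relation.Binary.PropositionalEquality
  using (_≡_; refl; sym; trans; cong; cong₂; subst; subst₂; module ≡-Reasoning)
open import Relation.Binary.PropositionalEquality.Properties using (setoid)
open import Relation.Nullary using (¬_; Dec; does; yes)
open import Relation.Nullary.Decidable using (toWitness; ⌊_⌋; _⊎-dec_; _×-dec_)

-- Walk counts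

card-unique : {A B : Set} → A ↔ B → (a : Finite A) (b : Finite B) → card a ≡ card b
card-unique f (_ , g) (_ , h) = ↔⇒≡ (h ↔-∘ (f ↔-∘ ↔-sym g))

-- The map `h` generalises the identity, so that the induction can pass to `h ∘ suc`.
card-Σ-T× : ∀ {n m} (h : Fin n → Fin m) (p : Fin m → Bool) {A : Fin m → Set}
            (A-fin : ∀ i → Finite (A i)) →
            card (Σ-finite (λ i → T×-finite (p (h i)) (A-fin (h i)))) ≡
            sum (map (card ∘ A-fin) (filterᵇ p (tabulate h)))
card-Σ-T× {zero}  h p A-fin = refl
card-Σ-T× {suc n} h p A-fin with p (h zero)
... | true  = cong (card (A-fin (h zero)) +_) (card-Σ-T× (h ∘ suc) p A-fin)
... | false = card-Σ-T× (h ∘ suc) p A-fin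

module _ (G : Graph) where
  open Graph G

  neighbours : Vertex → List Vertex
  neighbours x = filterᵇ (adj x) (allFin order)

  snoc : ∀ {k x y z} → Walk G k x y → Adj y z → Walk G (suc k) x z
  snoc stop       e = step e stop
  snoc (step d p) e = step d (snoc p e)

  reverse : ∀ {k x y} → Walk G k x y → Walk G k y x
  reverse stop       = stop
  reverse (step e p) = snoc (reverse p) (symmetric e)

  reverse-snoc : ∀ {k x y z} (p : Walk G k x y) (e : Adj y z) →
                 reverse (snoc p e) ≡ step (symmetric e) (reverse p)
  reverse-snoc stop       e = refl
  reverse-snoc (step d p) e = cong (λ q → snoc q (symmetric d)) (reverse-snoc p e)

  reverse-involutive : ∀ {k x y} (p : Walk G k x y) → reverse (reverse p) ≡ p
  reverse-involutive stop       = refl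
  reverse-involutive (step e p) =
    trans (reverse-snoc (reverse p) (symmetric e))
          -- Reversing twice turns `e` into `symmetric (symmetric e)`, another element of the same
          -- `T b`.
          (cong₂ step (T-irrelevant _ e) (reverse-involutive p))

  w-sym : ∀ k x y → w G k x y ≡ w G k y x
  w-sym k x y = card-unique
    (mk↔ₛ′ reverse reverse reverse-involutive reverse-involutive)
    (Walk-finite G k x y) (Walk-finite G k y x)

  w-first-step : ∀ k x z → w G (suc k) x z ≡ sum (map (λ y → w G k y z) (neighbours x))
  w-first-step k x z = card-Σ-T× (λ y → y) (adj x) (λ y → Walk-finite G k y z)

  w-last-step : ∀ k x z → w G (suc k) x z ≡ sum (map (w G k x) (neighbours z))
  w-last-step k x z = begin
    w G (suc k) x z                           ≡⟨ w-sym (suc k) x z ⟩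
    w G (suc k) z x                           ≡⟨ w-first-step k z x ⟩
    sum (map (λ y → w G k y x) (neighbours z)) ≡⟨ cong sum
      (List.map-cong (λ y → w-sym k y x) (neighbours z)) ⟩
    sum (map (w G k x) (neighbours z))         ∎
    where open ≡-Reasoning

-- Walk counts determined by the class of a pair

private
  module Sort (O : DecTotalOrder 0ℓ 0ℓ 0ℓ) =
    SortingAlgorithm (InsertionSort.insertionSort O)
  module ℕ-sort = Sort ℕ.≤-decTotalOrder

⌊⌋≡true⇒ : {A : Set} (a? : Dec A) → ⌊ a? ⌋ ≡ true → A
⌊⌋≡true⇒ a? eq = toWitness {a? = a?} (subst T (sym eq) tt)

-- A walk between vertices whose pair has class c arises by one step from walks
-- between pairs whose classes are listed in extensions c.
module WalkClasses (diagonal : ℕ → ℕ) (extensions : ℕ → List ℕ) where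

  walks : ℕ → ℕ → ℕ
  walks zero    c = diagonal c
  walks (suc k) c = sum (map (walks k) (extensions c))

  sum-walks : ∀ {A : Set} k {f class : A → ℕ} → (∀ a → f a ≡ walks k (class a)) →
              ∀ as c → ℕ-sort.sort (map class as) ≡ extensions c →
              sum (map f as) ≡ walks (suc k) c
  sum-walks k {f} {class} f-class as c sorted = begin
    sum (map f as)
      ≡⟨ cong sum (List.map-cong f-class as) ⟩
    sum (map (walks k ∘ class) as)
      ≡⟨ cong sum (List.map-∘ as) ⟩
    sum (map (walks k) (map class as))
      ≡⟨ sum-↭ (map⁺ (walks k) (↭-sym (ℕ-sort.sort-↭ (map class as)))) ⟩
    sum (map (walks k) (ℕ-sort.sort (map class as)))
      ≡⟨ cong (sum ∘ map (walks k)) sorted ⟩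
    walks (suc k) c
      ∎
    where open ≡-Reasoning

  module _ (G : Graph) (class : Graph.Vertex G → Graph.Vertex G → ℕ) where
    open Graph G

    Base FirstStep LastStep : Vertex → Vertex → Set
    Base x z =
      w G 0 x z ≡ diagonal (class x z)
    FirstStep x z =
      ℕ-sort.sort (map (λ y → class y z) (neighbours G x)) ≡ extensions (class x z)
    LastStep x z =
      ℕ-sort.sort (map (class x) (neighbours G z)) ≡ extensions (class x z)

    -- A point and a block have the same class in either order. The step is taken off at the block,
    -- which leaves two points; taken off at the point it would leave two blocks, whose intersection
    -- size the class does not fix.
    Regular : Set
    Regular = (∀ x z → Base x z) × (∀ x z → FirstStep x z ⊎ LastStep x z)

    regular? : Dec Regular
    regular? =
      Fin.all? (λ x → Fin.all? λ z → _ ℕ.≟ _) ×-dec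
      Fin.all? (λ x → Fin.all? λ z → List.≡-dec ℕ._≟_ _ _ ⊎-dec List.≡-dec ℕ._≟_ _ _)

    w-class : Regular → ∀ k x z → w G k x z ≡ walks k (class x z)
    w-class (base , _)       zero    x z = base x z
    w-class reg@(_ , extend) (suc k) x z with extend x z
    ... | inj₁ eq = trans (w-first-step G k x z)
      (sum-walks k (λ y → w-class reg k y z) (neighbours G x) (class x z) eq)
    ... | inj₂ eq = trans (w-last-step G k x z)
      (sum-walks k (w-class reg k x) (neighbours G z) (class x z) eq)

record Classified (W : ℕ → List ℕ) : Set where
  field
    graph : Graph
  open Graph graph public
  field
    class    : Vertex → Vertex → ℕ
    w*-class : ∀ x y → w* graph x y ≡ W (class x y)

-- Equality of profiles

-- Taking the first hit gives equal keys the same code, so codes can be compared across graphs.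
search : ∀ {n} → (Fin n → Bool) → Fin n → Fin n
search {n} p default = go (allFin n)
  where
  go : List (Fin n) → Fin n
  go []       = default
  go (i ∷ is) = if p i then i else go is

map-↭ : ∀ {A : Set} (S : Setoid 0ℓ 0ℓ) {f g : A → Setoid.Carrier S} →
        (∀ a → Setoid._≈_ S (f a) (g a)) → ∀ as → Setoid._≈_ (multiset S) (map f as) (map g as)
map-↭ S f≈g as = Permutation.↭-reflexive-≋ S
  (Pointwise.map⁺ _ _ (Pointwise.refl (λ {a} → f≈g a)))

module Refinement {W : ℕ → List ℕ} (G : Classified W) where
  open Classified

  -- The code of a vertex x of any graph X is a vertex of G of the same colour.
  Code : Set
  Code = Vertex G

  Codes : Classified W → Set
  Codes X = Vec Code (order X)

  private
    module Code-sort = Sort (Fin.≤-decTotalOrder (order G))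
    module Entry-sort =
      Sort (×-decTotalOrder ℕ.≤-decTotalOrder (Fin.≤-decTotalOrder (order G)))

  Signature : Set
  Signature = Code × List (ℕ × Code)

  _≟ₛ_ : DecidableEquality Signature
  _≟ₛ_ = Product.≡-dec Fin._≟_ (List.≡-dec (Product.≡-dec ℕ._≟_ Fin._≟_))

  entries : (X : Classified W) → Codes X → Vertex X → List (ℕ × Code)
  entries X cs x = map (λ y → class X x y , lookup cs y) (allFin (order X))

  signature : (X : Classified W) → Codes X → Vertex X → Signature
  signature X cs x = lookup cs x , Entry-sort.sort (entries X cs x)

  signatures : (X : Classified W) → Codes X → Vec Signature (order X)
  signatures X cs = Vec.tabulate (signature X cs)

  sortedCodes : (X : Classified W) → Codes X → List Code
  sortedCodes X cs = Code-sort.sort (map (lookup cs) (allFin (order X)))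

  Encodes : ℕ → (X : Classified W) → Codes X → Set
  Encodes r X cs = ∀ x →
    Setoid._≈_ (Colour r) (ω r (graph X) x) (ω r (graph G) (lookup cs x))

  -- One-sided: keys that split a colour could make the check reject, never accept wrongly.
  Separates : {S : Set} → ℕ → Vec S (order G) → (X : Classified W) → Vec S (order X) → Set
  Separates r sG X sX = ∀ x y → lookup sG y ≡ lookup sX x →
    Setoid._≈_ (Colour r) (ω r (graph X) x) (ω r (graph G) y)

  encodes-profile : ∀ r X cs → Encodes r X cs →
    Setoid._≈_ (multiset (Colour r))
      (profile r (graph X)) (map (ω r (graph G)) (sortedCodes X cs))
  encodes-profile r X cs enc = M.trans
    (subst (M._≈_ (profile r (graph X))) (List.map-∘ vertices) (map-↭ (Colour r) enc vertices))
    (↭⇒↭ₛ′ (Setoid.isEquivalence (Colour r))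
      (map⁺ (ω r (graph G)) (↭-sym (Code-sort.sort-↭ (map (lookup cs) vertices)))))
    where
    module M = Setoid (multiset (Colour r))
    vertices = allFin (order X)

  module _ (r : ℕ) where
    private
      Entry : Setoid 0ℓ 0ℓ
      Entry = ×-setoid (setoid (List ℕ)) (Colour r)

      module R = Setoid (Colour r)
      module M = Setoid (multiset Entry)

      decode : ℕ × Code → Setoid.Carrier Entry
      decode (c , y) = W c , ω r (graph G) y

    decode-entries : ∀ X cs → Encodes r X cs → ∀ x →
      proj₂ (ω (suc r) (graph X) x) M.≈ map decode (proj₂ (signature X cs x))
    decode-entries X cs enc x = M.trans
      (subst (M._≈_ (proj₂ (ω (suc r) (graph X) x))) (List.map-∘ vertices)
        (map-↭ Entry (λ y → w*-class X x y , enc y) vertices))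
      (↭⇒↭ₛ′ (Setoid.isEquivalence Entry)
        (map⁺ decode (↭-sym (Entry-sort.sort-↭ (entries X cs x)))))
      where vertices = allFin (order X)

    -- All codes name vertices of `G`, so a signature decodes to the same colour whichever graph it
    -- was read from.
    signatures-separate : ∀ X cG cX → Encodes r G cG → Encodes r X cX →
      Separates (suc r) (signatures G cG) X (signatures X cX)
    signatures-separate X cG cX encG encX x y eq =
      R.trans (encX x)
        (R.trans (R.reflexive (cong (ω r (graph G) ∘ proj₁) same)) (R.sym (encG y))) ,
      M.trans (decode-entries X cX encX x)
        (M.trans (M.reflexive (cong (map decode ∘ proj₂) same))
                 (M.sym (decode-entries G cG encG y)))
      where
      same : signature X cX x ≡ signature G cG y
      same = begin
        signature X cX x           ≡⟨ lookup∘tabulate (signature X cX) x ⟨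
        lookup (signatures X cX) x ≡⟨ eq ⟨
        lookup (signatures G cG) y ≡⟨ lookup∘tabulate (signature G cG) y ⟩
        signature G cG y           ∎
        where open ≡-Reasoning

  loops : (X : Classified W) → Vec ℕ (order X)
  loops X = Vec.tabulate (λ x → class X x x)

  loops-separate : ∀ X → Separates 0 (loops G) X (loops X)
  loops-separate X x y eq = begin
    w* (graph X) x x ≡⟨ w*-class X x x ⟩
    W (class X x x)  ≡⟨ cong W same ⟩
    W (class G y y)  ≡⟨ w*-class G y y ⟨
    w* (graph G) y y ∎
    where
    open ≡-Reasoning
    same : class X x x ≡ class G y y
    same = trans (sym (lookup∘tabulate _ x)) (trans (sym eq) (lookup∘tabulate _ y))

  -- The default only serves to avoid a partial function; valid? rejects the
  -- result when no vertex of G has the key s.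
  recode : {S : Set} → DecidableEquality S → Vec S (order G) →
           ∀ {n} → Vec Code n → Vec S n → Vec Code n
  recode _≟_ sG = Vec.zipWith (λ default s → search (λ y → does (lookup sG y ≟ s)) default)

  valid? : {S : Set} → DecidableEquality S → (sG : Vec S (order G)) →
           ∀ {n} (sX : Vec S n) (cs : Vec Code n) →
           Dec (∀ x → lookup sG (lookup cs x) ≡ lookup sX x)
  valid? _≟_ sG sX cs = Fin.all? (λ x → lookup sG (lookup cs x) ≟ lookup sX x)

  module _ (H : Classified W) where

    -- Keys and codes are passed as arguments, so that evaluation shares them.
    agree       : ℕ → Codes G → Codes H → Bool
    agree-keys  : {S : Set} → DecidableEquality S → ℕ →
                  Vec S (order G) → Vec S (order H) → Codes G → Codes H → Bool
    agree-codes : {S : Set} → DecidableEquality S → ℕ →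
                  Vec S (order G) → Vec S (order H) → Codes G → Codes H → Bool

    agree zero    cG cH = ⌊ List.≡-dec Fin._≟_ (sortedCodes G cG) (sortedCodes H cH) ⌋
    agree (suc k) cG cH = agree-keys _≟ₛ_ k (signatures G cG) (signatures H cH) cG cH

    agree-keys _≟_ k sG sH cG cH =
      agree-codes _≟_ k sG sH (recode _≟_ sG cG sG) (recode _≟_ sG cH sH)

    agree-codes _≟_ k sG sH cG cH =
      ⌊ valid? _≟_ sG sG cG ⌋ ∧ ⌊ valid? _≟_ sG sH cH ⌋ ∧ agree k cG cH

    -- Here `r` rounds are already encoded and `k` remain, so `k + r` is constant along the
    -- recursion.
    agree-sound : ∀ k r cG cH → Encodes r G cG → Encodes r H cH →
                  agree k cG cH ≡ true → graph G ≈[ k + r ] graph H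
    agree-keys-sound : ∀ k r {S : Set} (_≟_ : DecidableEquality S) sG sH cG cH →
                       Separates r sG G sG → Separates r sG H sH →
                       agree-keys _≟_ k sG sH cG cH ≡ true → graph G ≈[ k + r ] graph H
    agree-codes-sound : ∀ k r {S : Set} (_≟_ : DecidableEquality S) sG sH cG cH →
                        Separates r sG G sG → Separates r sG H sH →
                        agree-codes _≟_ k sG sH cG cH ≡ true → graph G ≈[ k + r ] graph H

    agree-sound zero r cG cH encG encH eq = M.trans (encodes-profile r G cG encG)
      (M.trans (M.reflexive (cong (map (ω r (graph G)))
                 (⌊⌋≡true⇒ (List.≡-dec Fin._≟_ (sortedCodes G cG) (sortedCodes H cH)) eq)))
               (M.sym (encodes-profile r H cH encH)))
      where module M = Setoid (multiset (Colour r))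
    agree-sound (suc k) r cG cH encG encH eq =
      subst (graph G ≈[_] graph H) (ℕ.+-suc k r)
        (agree-keys-sound k (suc r) _≟ₛ_ (signatures G cG) (signatures H cH) cG cH
          (signatures-separate r G cG cG encG encG)
          (signatures-separate r H cG cH encG encH) eq)

    agree-keys-sound k r _≟_ sG sH cG cH =
      agree-codes-sound k r _≟_ sG sH (recode _≟_ sG cG sG) (recode _≟_ sG cH sH)

    agree-codes-sound k r _≟_ sG sH cG cH sepG sepH eq
      with valid? _≟_ sG sG cG | valid? _≟_ sG sH cH | eq
    ... | yes validG | yes validH | eq′ =
      agree-sound k r cG cH (λ x → sepG x _ (validG x)) (λ x → sepH x _ (validH x)) eq′

    -- Level 0 has no earlier codes, so the recursion is entered at the keys; the identity and
    -- `default` are mere fallbacks for `recode`.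
    sameProfile : ℕ → Codes H → Bool
    sameProfile r default = agree-keys ℕ._≟_ r (loops G) (loops H) (Vec.tabulate id) default

    sameProfile-sound : ∀ r default → sameProfile r default ≡ true → graph G ≈[ r ] graph H
    sameProfile-sound r default eq = subst (graph G ≈[_] graph H) (ℕ.+-identityʳ r)
      (agree-keys-sound r 0 ℕ._≟_ (loops G) (loops H) (Vec.tabulate id) default
        (loops-separate G) (loops-separate H) eq)

-- Inequality of profiles

-- For a block b of a 2-(9,3,2) design, the sums of |b ∩ c| and |b ∩ c|² over all blocks c are
-- always 24 and 36. The cubes sum to 60 + 6m, where m is the multiplicity of b: the cube is the
-- first power that sees repeated blocks.
weight : List ℕ → ℕ
weight (_ ∷ _ ∷ w₂ ∷ _) = w₂ ^ 3
weight _                = 0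

-- Without the outer square, the symmetry of w_2 would make the total over x equal to Σ_y h_r(y) Σ_x
-- w_2(x,y)³, which for r ≥ 1 is already determined by ω^(r).
hash : ∀ r → Setoid.Carrier (Colour r) → ℕ
hash zero    _       = 1
hash (suc r) (_ , m) = sum (map (λ (ws , c) → weight ws * hash r c) m) ^ 2

sum-map-↭ : ∀ (S : Setoid 0ℓ 0ℓ) {f : Setoid.Carrier S → ℕ} →
            (∀ {a b} → Setoid._≈_ S a b → f a ≡ f b) →
            ∀ {as bs} → Setoid._≈_ (multiset S) as bs → sum (map f as) ≡ sum (map f bs)
sum-map-↭ S f-cong p = sum-↭ (↭ₛ⇒↭ (Permutationₚ.map⁺ S (setoid ℕ) f-cong p))

hash-cong : ∀ r {a b} → Setoid._≈_ (Colour r) a b → hash r a ≡ hash r b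
hash-cong zero    _       = refl
hash-cong (suc r) (_ , p) = cong (_^ 2)
  (sum-map-↭ (×-setoid (setoid (List ℕ)) (Colour r))
    (λ (ws≡ , c≈) → cong₂ (λ ws h → weight ws * h) ws≡ (hash-cong r c≈)) p)

module _ {W : ℕ → List ℕ} (X : Classified W) where
  open Classified X

  rehash : Vec ℕ order → Vec ℕ order
  rehash hs = Vec.tabulate λ x →
    sum (map (λ y → weight (W (class x y)) * lookup hs y) (allFin order)) ^ 2

  hashes : ℕ → Vec ℕ order
  hashes zero    = Vec.replicate order 1
  hashes (suc r) = rehash (hashes r)

  lookup-hashes : ∀ r x → lookup (hashes r) x ≡ hash r (ω r graph x)
  lookup-hashes zero    x = lookup-replicate x 1
  lookup-hashes (suc r) x = trans (lookup∘tabulate _ x) (cong ((_^ 2) ∘ sum) (trans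
    (List.map-cong (λ y → cong₂ (λ ws h → weight ws * h)
                                (sym (w*-class x y)) (lookup-hashes r y)) (allFin order))
    (List.map-∘ (allFin order))))

  sumOver : Vec ℕ order → ℕ
  sumOver hs = sum (map (lookup hs) (allFin order))

  total : ℕ → ℕ
  total r = sumOver (hashes r)

  total-hash : ∀ r → total r ≡ sum (map (hash r) (profile r graph))
  total-hash r = cong sum
    (trans (List.map-cong (lookup-hashes r) (allFin order)) (List.map-∘ (allFin order)))

total-invariant : ∀ {W} (X Y : Classified W) r →
  Classified.graph X ≈[ r ] Classified.graph Y → total X r ≡ total Y r
total-invariant X Y r p = begin
  total X r                                         ≡⟨ total-hash X r ⟩
  sum (map (hash r) (profile r (Classified.graph X))) ≡⟨ sum-map-↭ (Colour r) (hash-cong r) p ⟩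
  sum (map (hash r) (profile r (Classified.graph Y))) ≡⟨ total-hash Y r ⟨
  total Y r                                         ∎
  where open ≡-Reasoning

-- Designs

-- A block is a three-digit number; its digits are its points, numbered 1 to 9.
_∈ᵇ_ : Fin 9 → ℕ → Bool
p ∈ᵇ b = any (suc (toℕ p) ≡ᵇ_) (b / 100 ∷ b / 10 % 10 ∷ b % 10 ∷ [])

∣_∩_∣ : ℕ → ℕ → ℕ
∣ b ∩ c ∣ = length (filterᵇ (λ p → (p ∈ᵇ b) ∧ (p ∈ᵇ c)) (allFin 9))

module Design (blocks : Vec ℕ 24) where

  Object : Set
  Object = Fin 9 ⊎ Fin 24

  incident : Object → Object → Bool
  incident (inj₁ p) (inj₂ i) = p ∈ᵇ lookup blocks i
  incident (inj₂ i) (inj₁ p) = p ∈ᵇ lookup blocks i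
  incident _        _        = false

  incident-sym : ∀ s t → T (incident s t) → T (incident t s)
  incident-sym (inj₁ _) (inj₂ _) e = e
  incident-sym (inj₂ _) (inj₁ _) e = e

  incident-irrefl : ∀ s → ¬ T (incident s s)
  incident-irrefl (inj₁ _) ()
  incident-irrefl (inj₂ _) ()

  incidenceGraph : Graph
  incidenceGraph = record
    { order       = 33
    ; adj         = λ x y → incident (splitAt 9 x) (splitAt 9 y)
    ; symmetric   = λ {x} {y} → incident-sym (splitAt 9 x) (splitAt 9 y)
    ; irreflexive = λ { {x} refl → incident-irrefl (splitAt 9 x) }
    }

  -- Distinct blocks get 4 to 7. Two copies of a repeated block are different vertices and get 7,
  -- not 8.
  relation : Object → Object → ℕ
  relation (inj₁ p) (inj₁ q) = if does (p Fin.≟ q) then 0 else 1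
  relation (inj₂ i) (inj₂ j) =
    if does (i Fin.≟ j) then 8 else 4 + ∣ lookup blocks i ∩ lookup blocks j ∣
  relation s        t        = if incident s t then 2 else 3

  pairClass : Fin 33 → Fin 33 → ℕ
  pairClass x y = relation (splitAt 9 x) (splitAt 9 y)

diagonal : ℕ → ℕ
diagonal 0 = 1
diagonal 8 = 1
diagonal _ = 0

-- Each point lies on 8 blocks, and two points lie on 2 common blocks.  In the last
-- clause i is the intersection size of two blocks.
extensions : ℕ → List ℕ
extensions 0 = replicate 8 2
extensions 1 = replicate 2 2 ++ replicate 6 3
extensions 2 = 0 ∷ 1 ∷ 1 ∷ []
extensions 3 = 1 ∷ 1 ∷ 1 ∷ []
extensions 8 = 2 ∷ 2 ∷ 2 ∷ []
extensions (suc (suc (suc (suc i)))) = replicate i 2 ++ replicate (3 ∸ i) 3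

open WalkClasses diagonal extensions

walkSequence : ℕ → List ℕ
walkSequence c = map (λ k → walks k c) (upTo 33)

-- The equation also certifies a 2-(9,3,2) design: classes 0, 1 and 8 force eight blocks through a
-- point, two through a pair of points and three points on a block.
classified : (blocks : Vec ℕ 24) →
             ⌊ regular? (Design.incidenceGraph blocks) (Design.pairClass blocks) ⌋ ≡ true →
             Classified walkSequence
classified blocks regular = record
  { graph    = incidenceGraph
  ; class    = pairClass
  ; w*-class = λ x y → List.map-cong (λ k → w-class incidenceGraph pairClass
      (⌊⌋≡true⇒ (regular? incidenceGraph pairClass) regular) k x y) (upTo 33)
  }
  where open Design blocks

-- The five designs

blocks₁ : Vec ℕ 24
blocks₁ =
  127 ∷ 129 ∷ 136 ∷ 139 ∷ 145 ∷ 145 ∷ 168 ∷ 178 ∷ 238 ∷ 238 ∷ 246 ∷ 247 ∷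
  256 ∷ 259 ∷ 347 ∷ 349 ∷ 356 ∷ 357 ∷ 468 ∷ 489 ∷ 578 ∷ 589 ∷ 679 ∷ 679 ∷ []

blocks₂ : Vec ℕ 24
blocks₂ =
  127 ∷ 128 ∷ 137 ∷ 138 ∷ 146 ∷ 146 ∷ 159 ∷ 159 ∷ 234 ∷ 239 ∷ 248 ∷ 256 ∷
  257 ∷ 269 ∷ 345 ∷ 356 ∷ 367 ∷ 389 ∷ 458 ∷ 479 ∷ 479 ∷ 578 ∷ 678 ∷ 689 ∷ []

-- This design and the next two have one repeated block B. Its copies use up the pairs of points in
-- B, so 18 other blocks meet B in one point and 4 are disjoint from it. As ω_2 sees no more than
-- this, ω^(2) agrees on all three.
blocks₃ : Vec ℕ 24
blocks₃ =
  123 ∷ 124 ∷ 134 ∷ 157 ∷ 158 ∷ 168 ∷ 169 ∷ 179 ∷ 235 ∷ 247 ∷ 256 ∷ 268 ∷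
  279 ∷ 289 ∷ 348 ∷ 359 ∷ 367 ∷ 367 ∷ 389 ∷ 456 ∷ 459 ∷ 469 ∷ 478 ∷ 578 ∷ []

blocks₄ : Vec ℕ 24
blocks₄ =
  124 ∷ 126 ∷ 135 ∷ 136 ∷ 148 ∷ 158 ∷ 179 ∷ 179 ∷ 236 ∷ 238 ∷ 247 ∷ 257 ∷
  259 ∷ 289 ∷ 347 ∷ 349 ∷ 359 ∷ 378 ∷ 456 ∷ 458 ∷ 469 ∷ 567 ∷ 678 ∷ 689 ∷ []

blocks₅ : Vec ℕ 24
blocks₅ =
  128 ∷ 128 ∷ 134 ∷ 137 ∷ 149 ∷ 156 ∷ 159 ∷ 167 ∷ 237 ∷ 239 ∷ 246 ∷ 249 ∷
  256 ∷ 257 ∷ 346 ∷ 358 ∷ 359 ∷ 368 ∷ 457 ∷ 458 ∷ 478 ∷ 679 ∷ 689 ∷ 789 ∷ []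

X₁ X₂ X₃ X₄ X₅ : Classified walkSequence
X₁ = classified blocks₁ refl
X₂ = classified blocks₂ refl
X₃ = classified blocks₃ refl
X₄ = classified blocks₄ refl
X₅ = classified blocks₅ refl

-- Separation of consecutive levels

determines-predecessor : ∀ r → suc r Determines r
determines-predecessor r G H p =
  subst₂ (Setoid._≈_ (multiset (Colour r)))
    (sym (List.map-∘ (allFin (Graph.order G)))) (sym (List.map-∘ (allFin (Graph.order H))))
    (Permutationₚ.map⁺ (Colour (suc r)) (Colour r) proj₁ p)

strict : ∀ r G H → G ≈[ r ] H → ¬ (G ≈[ suc r ] H) →
  (∃₂ λ (G H : Graph) → G ≈[ r ] H × ¬ (G ≈[ suc r ] H)) × r StrictlyWeakerThan (suc r)
strict r G H same distinct =
  (G , H , same , distinct) ,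
  determines-predecessor r , λ determines → distinct (determines G H same)

separate : ∀ r (X Y : Classified walkSequence) (default : Refinement.Codes X Y) →
  Refinement.sameProfile X Y r default ≡ true → ¬ (total X (suc r) ≡ total Y (suc r)) →
  (∃₂ λ (G H : Graph) → G ≈[ r ] H × ¬ (G ≈[ suc r ] H)) × r StrictlyWeakerThan (suc r)
separate r X Y default same distinct =
  strict r (Classified.graph X) (Classified.graph Y)
    (Refinement.sameProfile-sound X Y r default same)
    (λ p → distinct (total-invariant X Y (suc r) p))

theorem6p6 : ∀ (r : ℕ) → 1 ≤ r → r ≤ 3 →
    (∃₂ λ (G H : Graph) → G ≈[ r ] H × ¬ (G ≈[ suc r ] H))
    × r StrictlyWeakerThan (suc r)
theorem6p6 0 () _
-- Both designs have three repeated blocks: pairwise disjoint in `X₁`, pairwise meeting in one point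
-- in `X₂`.
theorem6p6 1 _ _ = separate 1 X₁ X₂ (Vec.tabulate id) refl (λ ())
-- The four blocks disjoint from the repeated one meet pairwise in one point in `X₃` (a Pasch
-- configuration), while in `X₄` 236 and 238 share two points.
theorem6p6 2 _ _ = separate 2 X₃ X₄ (Vec.tabulate id) refl (λ ())
-- Now both quadruples are Pasch configurations, and the difference lies one round deeper.
theorem6p6 3 _ _ = separate 3 X₃ X₅ (Vec.tabulate id) refl (λ ())
theorem6p6 (suc (suc (suc (suc _)))) _ (s≤s (s≤s (s≤s ())))
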